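{- Let $A\subseteq\omega$ be an infinite c.e. set, let $\theta$ be a quasi-Gödel numbering of $\mathcal S^{(1)}_A$ and let $\varphi$ be a Gödel numbering of $\mathcal P^{(1)}$. Then $(\mathcal S^{(1)}_A,\theta)$ is a retract of $(\mathcal P^{(1)},\varphi)$.
   Context: $\omega$ is the set of natural numbers; $\mathcal P^{(n)}$ and $\mathcal R^{(n)}$ are the sets of $n$-ary partial, respectively total, computable functions on $\omega$. $\langle\cdot,\cdot\rangle:\omega^2\to\omega$ is a computable bijection with $\langle x,y\rangle\ge x,y$. $\mathrm{Anf}^{(1)}_A$ is the set of partial functions from $\omega$ to $\omega$ whose domain is either empty or equal to $\{0,\dots,a-1\}$ for some $a\in A$, and $\mathcal S^{(1)}_A=\mathcal R^{(1)}\cup\mathrm{Anf}^{(1)}_A$. The extended graph of a unary partial function $q$ is $\{\langle y,0\rangle:y\in\omega\}\cup\{\langle x,q(x)+1\rangle:x\in\mathrm{dom}(q)\}$; that of a binary partial function $q$ is $\{\langle\langle y,y'\rangle,0\rangle:y,y'\in\omega\}\cup\{\langle\langle x,x'\rangle,q(x,x')+1\rangle:(x,x')\in\mathrm{dom}(q)\}$. A numbering of a set $X$ is a surjection $\omega\to X$. A numbering $\theta$ of $\mathcal S^{(1)}_A$ is a quasi-Gödel numbering if: (QGN I) the extended graph of $(i,x)\mapsto\theta_i(x)$ is the range of a function in $\mathcal R^{(1)}$; and (QGN II) for every $k\in\mathcal R^{(2)}$ there is $v\in\mathcal R^{(1)}$ such that for all $i\in\omega$, $r\in\mathcal S^{(1)}_A$: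 if $\{k(i,t):t\in\omega\}$ is the extended graph of $r$, then $r=\theta_{v(i)}$. A Gödel numbering of $\mathcal P^{(1)}$ is a numbering $\varphi$ with partial computable universal function $(i,x)\mapsto\varphi_i(x)$ such that for every $g\in\mathcal P^{(2)}$ there is $s\in\mathcal R^{(1)}$ with $\varphi_{s(i)}(x)=g(i,x)$ for all $i,x$. For $Z\subseteq\mathcal P^{(1)}$ with a numbering $\zeta$, $(Z,\zeta)$ is a retract of $(\mathcal P^{(1)},\varphi)$ if (a) $\zeta\le_m\varphi$, i.e. $\zeta=\varphi\circ g$ for some $g\in\mathcal R^{(1)}$, and (b) there are an idempotent map $H$ from $\mathcal P^{(1)}$ onto $Z$ and some $h\in\mathcal R^{(1)}$ such that $H(\varphi_i)=\zeta_{h(i)}$ for all $i\in\omega$. -}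

module Defs where

open import Level using (0ℓ; suc)
open import Data.Nat.Base as ℕ using (ℕ; _≤_; _<_)
open import Data.Fin.Base using (Fin)
open import Data.List.Base using (List)
import Data.List.Membership.Propositional as List
open import Data.Product.Base using (Σ; ∃; ∃₂; _×_; _,_; proj₁; proj₂; uncurry)
open import Data.Vec.Base using (Vec; []; _∷_; lookup)
open import Data.Vec.N-ary using (N-ary; _$ⁿ_)
open import Data.Vec.Relation.Binary.Pointwise.Inductive using (Pointwise)
open import Function.Bundles using (_⇔_; Surjection)
open import Function.Definitions using (Bijective)
open import Function.Properties.Equivalence using (⇔-isEquivalence)
open import Relation.Binary.Bundles using (Setoid)
open import Relation.Binary.Structures using (IsEquivalence)
import Relation.Binary.Construct.On as On
open import Relation.Binary.PropositionalEquality using (_≡_; sym; trans; setoid)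
open import Relation.Nullary using (¬_)
open import Relation.Unary using (Pred; _∈_; _⊆_; _≐_; _∪_; ∅)

-- An n-ary partial function is a single-valued graph; neither its values nor
-- its domain need be computable.
record PFun (n : ℕ) : Set₁ where
  field
    graph      : Vec ℕ n → ℕ → Set
    functional : ∀ {xs y y′} → graph xs y → graph xs y′ → y ≡ y′

open PFun public

infix 4 _≈_

_≈_ : ∀ {n} → PFun n → PFun n → Set
p ≈ q = ∀ xs y → graph p xs y ⇔ graph q xs y

≈-isEquivalence : ∀ {n} → IsEquivalence (_≈_ {n})
≈-isEquivalence = record
  { refl  = λ _ _ → E.refl
  ; sym   = λ p≈q xs y → E.sym (p≈q xs y)
  ; trans = λ p≈q q≈r xs y → E.trans (p≈q xs y) (q≈r xs y)
  }
  where module E = IsEquivalence (⇔-isEquivalence {0ℓ})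

PFun-setoid : ℕ → Setoid (suc 0ℓ) 0ℓ
PFun-setoid n = record { isEquivalence = ≈-isEquivalence {n} }

-- A set of partial functions, as a setoid under extensional equality.
⟦_⟧ : ∀ {n} → Pred (PFun n) 0ℓ → Setoid (suc 0ℓ) 0ℓ
⟦_⟧ {n} X = On.setoid (PFun-setoid n) (proj₁ {B = X})

Dom : PFun 1 → Pred ℕ 0ℓ
Dom p x = ∃ λ y → graph p (x ∷ []) y

-- The n is explicit because it cannot be inferred from f : ℕ → ⋯ → ℕ.
total : ∀ n → N-ary n ℕ ℕ → PFun n
total n f = record
  { graph      = λ xs y → (f $ⁿ xs) ≡ y
  ; functional = λ e e′ → trans (sym e) e′
  }

section : PFun 2 → ℕ → PFun 1
section g i = record
  { graph      = λ xs y → graph g (i ∷ xs) y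
  ; functional = functional g
  }

-- The μ-recursive functions; their arguments are vectors, and the recursion
-- and search variable comes first.
data Code : ℕ → Set where
  zer  : Code 0
  succ : Code 1
  proj : ∀ {n} → Fin n → Code n
  comp : ∀ {m n} → Code m → Vec (Code n) m → Code n
  prec : ∀ {n} → Code n → Code (2 ℕ.+ n) → Code (1 ℕ.+ n)
  mu   : ∀ {n} → Code (1 ℕ.+ n) → Code n

infix 4 _[_]⇓_

-- c [ xs ]⇓ y : the function with code c is defined at xs, with value y.
data _[_]⇓_ : ∀ {n} → Code n → Vec ℕ n → ℕ → Set where
  zer⇓  : zer [ [] ]⇓ 0
  succ⇓ : ∀ {x} → succ [ x ∷ [] ]⇓ ℕ.suc x
  proj⇓ : ∀ {n} {xs : Vec ℕ n} i → proj i [ xs ]⇓ lookup xs i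
  comp⇓ : ∀ {m n} {f : Code m} {gs : Vec (Code n) m} {xs ys z} →
          Pointwise (λ g y → g [ xs ]⇓ y) gs ys →
          f [ ys ]⇓ z →
          comp f gs [ xs ]⇓ z
  prec₀ : ∀ {n} {f : Code n} {g xs y} →
          f [ xs ]⇓ y →
          prec f g [ 0 ∷ xs ]⇓ y
  prec₊ : ∀ {n} {f : Code n} {g k xs y z} →
          prec f g [ k ∷ xs ]⇓ y →
          g [ k ∷ y ∷ xs ]⇓ z →
          prec f g [ ℕ.suc k ∷ xs ]⇓ z
  mu⇓   : ∀ {n} {f : Code (1 ℕ.+ n)} {xs y} →
          (∀ z → z < y → ∃ λ v → f [ z ∷ xs ]⇓ ℕ.suc v) →
          f [ y ∷ xs ]⇓ 0 →
          mu f [ xs ]⇓ y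

-- 𝓟 / 𝓡: the partial / total computable functions; computability is asserted
-- by the existence of a code, so _≈_ never compares codes.
𝓟 : ∀ {n} → Pred (PFun n) 0ℓ
𝓟 p = ∃ λ c → ∀ xs y → graph p xs y ⇔ c [ xs ]⇓ y

𝓡 : ∀ {n} → Pred (PFun n) 0ℓ
𝓡 p = p ∈ 𝓟 × (∀ xs → ∃ λ y → graph p xs y)

Range : (ℕ → ℕ) → Pred ℕ 0ℓ
Range f y = ∃ λ x → f x ≡ y

RangeOfComputable : Pred (Pred ℕ 0ℓ) 0ℓ
RangeOfComputable A = ∃ λ f → total 1 f ∈ 𝓡 × A ≐ Range f

CE : Pred (Pred ℕ 0ℓ) 0ℓ
CE = (_≐ ∅) ∪ RangeOfComputable

Infinite : Pred (Pred ℕ 0ℓ) 0ℓ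
Infinite A = ¬ ∃ λ (xs : List ℕ) → A ⊆ (List._∈ xs)

record Pairing : Set where
  field
    ⟨_,_⟩      : ℕ → ℕ → ℕ
    computable : total 2 ⟨_,_⟩ ∈ 𝓡
    bijective  : Bijective _≡_ _≡_ (uncurry ⟨_,_⟩)
    ≥-left     : ∀ x y → x ≤ ⟨ x , y ⟩
    ≥-right    : ∀ x y → y ≤ ⟨ x , y ⟩

module ExtendedGraph (π : Pairing) where
  open Pairing π

  ExtGraph₁ : PFun 1 → Pred ℕ 0ℓ
  ExtGraph₁ q =
    (λ z → ∃ λ y → z ≡ ⟨ y , 0 ⟩) ∪
    (λ z → ∃₂ λ x y → graph q (x ∷ []) y × z ≡ ⟨ x , ℕ.suc y ⟩)

  ExtGraph₂ : PFun 2 → Pred ℕ 0ℓ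
  ExtGraph₂ q =
    (λ z → ∃₂ λ y y′ → z ≡ ⟨ ⟨ y , y′ ⟩ , 0 ⟩) ∪
    (λ z → ∃₂ λ x x′ → ∃ λ y →
      graph q (x ∷ x′ ∷ []) y × z ≡ ⟨ ⟨ x , x′ ⟩ , ℕ.suc y ⟩)

Anf : Pred ℕ 0ℓ → Pred (PFun 1) 0ℓ
Anf A = (λ p → Dom p ≐ ∅) ∪ (λ p → ∃ λ a → a ∈ A × Dom p ≐ (_< a))

𝓢 : Pred ℕ 0ℓ → Pred (PFun 1) 0ℓ
𝓢 A = 𝓡 ∪ Anf A

Numbering : Pred (PFun 1) 0ℓ → Set₁
Numbering X = Surjection (setoid ℕ) ⟦ X ⟧

infix 9 _at_

_at_ : ∀ {X} → Numbering X → ℕ → PFun 1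
ν at i = proj₁ (Surjection.to ν i)

universal : ∀ {X} → Numbering X → PFun 2
universal ν = record
  { graph      = λ { (i ∷ xs) y → graph (ν at i) xs y }
  ; functional = λ { {i ∷ xs} → functional (ν at i) }
  }

record IsQuasiGödel (π : Pairing) (A : Pred ℕ 0ℓ) (θ : Numbering (𝓢 A)) : Set₁ where
  open ExtendedGraph π
  field
    QGN-I  : RangeOfComputable (ExtGraph₂ (universal θ))
    QGN-II : ∀ (k : ℕ → ℕ → ℕ) → total 2 k ∈ 𝓡 →
             ∃ λ (v : ℕ → ℕ) → total 1 v ∈ 𝓡 ×
               (∀ i r → r ∈ 𝓢 A → Range (k i) ≐ ExtGraph₁ r → r ≈ θ at (v i))

record IsGödel (φ : Numbering 𝓟) : Set₁ where
  field
    universal∈𝓟 : universal φ ∈ 𝓟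
    smn         : ∀ (g : PFun 2) → g ∈ 𝓟 →
                  ∃ λ (s : ℕ → ℕ) → total 1 s ∈ 𝓡 ×
                    (∀ i → φ at (s i) ≈ section g i)

infix 4 _≤ₘ_

_≤ₘ_ : ∀ {X Y} → Numbering X → Numbering Y → Set
ζ ≤ₘ φ = ∃ λ (g : ℕ → ℕ) → total 1 g ∈ 𝓡 × (∀ i → ζ at i ≈ φ at (g i))

record IsRetract (Z : Pred (PFun 1) 0ℓ) (ζ : Numbering Z) (φ : Numbering 𝓟) : Set₁ where
  field
    Z⊆𝓟   : Z ⊆ 𝓟
    ζ≤ₘφ  : ζ ≤ₘ φ
    -- A map of setoids, so it depends only on the partial function, not on a
    -- code for it.
    H     : Surjection ⟦ 𝓟 {1} ⟧ ⟦ Z ⟧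

  map : Σ (PFun 1) 𝓟 → Σ (PFun 1) Z
  map = Surjection.to H

  field
    idempotent : ∀ p → proj₁ (map (proj₁ (map p) , Z⊆𝓟 (proj₂ (map p)))) ≈ proj₁ (map p)
    tracked    : ∃ λ (h : ℕ → ℕ) → total 1 h ∈ 𝓡 ×
                   (∀ i → proj₁ (map (Surjection.to φ i)) ≈ ζ at (h i))

{-# OPTIONS --safe #-}
module Submission where

-- H restricts p to the union of the initial segments {0, …, a−1}, a ∈ A, on which
-- p is defined. The restriction depends only on p, lies in 𝓢 A, and, A being
-- infinite, equals p if p ∈ 𝓢 A. It is partial computable uniformly in a
-- φ-index; since the extended graph of φ i is enumerable uniformly in i, QGN-II
-- turns φ-indices of members of 𝓢 A into θ-indices.
--
-- Constructively, membership of the restriction in 𝓢 A is available only up to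
-- double negation. This suffices: the values of θ carry their membership in 𝓢 A,
-- so their graphs are decidable and equality on 𝓢 A is ¬¬-stable. Deriving the
-- doubly negated membership needs Markov's principle for the domains of φ, which
-- follows from that decidability by a self-referential construction.

open import Defs
open import Level using (0ℓ)
open import Data.Empty using (⊥-elim)
open import Data.Fin.Base using (Fin; suc; _↑ʳ_)
open import Data.Fin.Patterns using (0F; 1F; 2F; 3F)
open import Data.List.Base using ([]; upTo)
open import Data.List.Membership.Propositional.Properties using (∈-upTo⁺)
open import Data.Nat.Base using (ℕ; zero; suc; _+_; _∸_; _≤_; _<_; _⊔_; z≤n; s≤s; pred)
open import Data.Nat.Properties
open import Data.Product.Base using (Σ; ∃; ∃₂; _×_; _,_; proj₁; proj₂)
open import Data.Sum.Base using (_⊎_; inj₁; inj₂)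
open import Data.Vec.Base using (Vec; []; _∷_; lookup; map; tabulate; _++_; drop)
open import Data.Vec.Properties using (tabulate∘lookup)
open import Data.Vec.Relation.Binary.Pointwise.Inductive using (Pointwise; []; _∷_)
open import Data.Vec.Relation.Unary.All using (All; []; _∷_)
open import Function.Base using (_∘_; id)
open import Function.Bundles using (_⇔_; Surjection; mk⇔; Equivalence)
open import Relation.Binary.Definitions using (tri<; tri≈; tri>)
open import Relation.Binary.Structures using (IsEquivalence)
open import Relation.Binary.PropositionalEquality
open import Relation.Nullary using (¬_; Dec; yes; no; contradiction)
open import Relation.Nullary.Decidable using (decidable-stable; ¬¬-excluded-middle)
open import Relation.Unary using (Pred; _∈_; _⊆_; _≐_)

open Equivalence using (to; from)

private
  variable
    m n : ℕ

-- Determinism of evaluation.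

mutual
  ⇓-deterministic : (c : Code n) → ∀ {xs y y′} → c [ xs ]⇓ y → c [ xs ]⇓ y′ → y ≡ y′
  ⇓-deterministic zer zer⇓ zer⇓ = refl
  ⇓-deterministic succ succ⇓ succ⇓ = refl
  ⇓-deterministic (proj i) (proj⇓ .i) (proj⇓ .i) = refl
  ⇓-deterministic (comp f gs) (comp⇓ ds d) (comp⇓ ds′ d′)
    with refl ← ⇓-deterministics gs ds ds′ = ⇓-deterministic f d d′
  ⇓-deterministic (prec f g) (prec₀ d) (prec₀ d′) = ⇓-deterministic f d d′
  ⇓-deterministic (prec f g) (prec₊ d e) (prec₊ d′ e′)
    with refl ← ⇓-deterministic (prec f g) d d′ = ⇓-deterministic g e e′
  ⇓-deterministic (mu f) {y = y} {y′} (mu⇓ h d) (mu⇓ h′ d′) with <-cmp y y′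
  ... | tri≈ _ y≡y′ _ = y≡y′
  ... | tri< y<y′ _ _ = contradiction (⇓-deterministic f d (proj₂ (h′ y y<y′))) λ ()
  ... | tri> _ _ y′<y = contradiction (⇓-deterministic f d′ (proj₂ (h y′ y′<y))) λ ()

  ⇓-deterministics : (gs : Vec (Code n) m) → ∀ {xs ys ys′} →
    Pointwise (λ g y → g [ xs ]⇓ y) gs ys → Pointwise (λ g y → g [ xs ]⇓ y) gs ys′ → ys ≡ ys′
  ⇓-deterministics [] [] [] = refl
  ⇓-deterministics (g ∷ gs) (d ∷ ds) (d′ ∷ ds′) =
    cong₂ _∷_ (⇓-deterministic g d d′) (⇓-deterministics gs ds ds′)

codeFun : Code n → PFun n
codeFun c = record { graph = c [_]⇓_ ; functional = ⇓-deterministic c }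

codeFun∈𝓟 : (c : Code n) → codeFun c ∈ 𝓟
codeFun∈𝓟 c = c , λ _ _ → mk⇔ id id

-- Total computable functions

-- Pairing a code with its value function lets programs be reasoned about by computing values in
-- Agda; convergence is proved once per combinator.
record Total (n : ℕ) : Set where
  field
    code   : Code n
    ⟪_⟫    : Vec ℕ n → ℕ
    apply⇓ : ∀ xs → code [ xs ]⇓ ⟪_⟫ xs

open Total

codes : Vec (Total n) m → Vec (Code n) m
codes []       = []
codes (g ∷ gs) = code g ∷ codes gs

values : Vec (Total n) m → Vec ℕ n → Vec ℕ m
values []       xs = []
values (g ∷ gs) xs = ⟪ g ⟫ xs ∷ values gs xs

values⇓ : (gs : Vec (Total n) m) → ∀ xs → Pointwise (λ g y → g [ xs ]⇓ y) (codes gs) (values gs xs)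
values⇓ []       xs = []
values⇓ (g ∷ gs) xs = apply⇓ g xs ∷ values⇓ gs xs

-- Keeps the code but swaps in a more readable value function, so that later goals reduce to
-- ordinary arithmetic.
withValues : (F : Total n) (f : Vec ℕ n → ℕ) → (∀ xs → ⟪ F ⟫ xs ≡ f xs) → Total n
withValues F f F≡f = record
  { code   = code F
  ; ⟪_⟫    = f
  ; apply⇓ = λ xs → subst (code F [ xs ]⇓_) (F≡f xs) (apply⇓ F xs)
  }

var : Fin n → Total n
var i = record { code = proj i ; ⟪_⟫ = λ xs → lookup xs i ; apply⇓ = λ _ → proj⇓ i }

infixl 8 _∘[_]

_∘[_] : Total m → Vec (Total n) m → Total n
F ∘[ Gs ] = record
  { code   = comp (code F) (codes Gs)
  ; ⟪_⟫    = λ xs → ⟪ F ⟫ (values Gs xs)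
  ; apply⇓ = λ xs → comp⇓ (values⇓ Gs xs) (apply⇓ F _)
  }

remainingVars : ∀ k → Vec (Total (k + n)) n
remainingVars k = tabulate (λ i → var (k ↑ʳ i))

values-++ : ∀ {l} (gs : Vec (Total n) m) (hs : Vec (Total n) l) xs →
  values (gs ++ hs) xs ≡ values gs xs ++ values hs xs
values-++ []       hs xs = refl
values-++ (g ∷ gs) hs xs = cong (_ ∷_) (values-++ gs hs xs)

values-tabulate : (g : Fin m → Total n) → ∀ xs →
  values (tabulate g) xs ≡ tabulate (λ i → ⟪ g i ⟫ xs)
values-tabulate {zero}  g xs = refl
values-tabulate {suc m} g xs = cong (_ ∷_) (values-tabulate (g ∘ suc) xs)

tabulate-lookup-↑ʳ : ∀ k (xs : Vec ℕ (k + n)) → tabulate (λ i → lookup xs (k ↑ʳ i)) ≡ drop k xs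
tabulate-lookup-↑ʳ zero    xs       = tabulate∘lookup xs
tabulate-lookup-↑ʳ (suc k) (x ∷ xs) = tabulate-lookup-↑ʳ k xs

values-remainingVars : ∀ k (xs : Vec ℕ (k + n)) → values (remainingVars k) xs ≡ drop k xs
values-remainingVars k xs = trans (values-tabulate _ xs) (tabulate-lookup-↑ʳ k xs)

substFirst : ∀ k → Total (m + n) → Vec (Total (k + n)) m → Total (k + n)
substFirst k F Gs = withValues (F ∘[ Gs ++ remainingVars k ])
  (λ xs → ⟪ F ⟫ (values Gs xs ++ drop k xs))
  (λ xs → cong ⟪ F ⟫ (trans (values-++ Gs _ xs) (cong (values Gs xs ++_) (values-remainingVars k xs))))

primRec : (Vec ℕ n → ℕ) → (Vec ℕ (2 + n) → ℕ) → ℕ → Vec ℕ n → ℕ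
primRec f g zero    xs = f xs
primRec f g (suc k) xs = g (k ∷ primRec f g k xs ∷ xs)

primrec : Total n → Total (2 + n) → Total (1 + n)
primrec F G = record
  { code   = prec (code F) (code G)
  ; ⟪_⟫    = λ { (k ∷ xs) → primRec ⟪ F ⟫ ⟪ G ⟫ k xs }
  ; apply⇓ = λ { (k ∷ xs) → go k xs }
  }
  where
  go : ∀ k xs → prec (code F) (code G) [ k ∷ xs ]⇓ primRec ⟪ F ⟫ ⟪ G ⟫ k xs
  go zero    xs = prec₀ (apply⇓ F xs)
  go (suc k) xs = prec₊ (go k xs) (apply⇓ G _)

zeroᵗ : Total 0
zeroᵗ = record { code = zer ; ⟪_⟫ = λ _ → 0 ; apply⇓ = λ { [] → zer⇓ } }

successor : Total 1
successor = record { code = succ ; ⟪_⟫ = λ { (x ∷ []) → suc x } ; apply⇓ = λ { (x ∷ []) → succ⇓ } }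

sucᵗ : Total n → Total n
sucᵗ F = successor ∘[ F ∷ [] ]

constCode : ℕ → Code n
constCode zero    = comp zer []
constCode (suc k) = comp succ (constCode k ∷ [])

constCode⇓ : ∀ k (xs : Vec ℕ n) → constCode k [ xs ]⇓ k
constCode⇓ zero    xs = comp⇓ [] zer⇓
constCode⇓ (suc k) xs = comp⇓ (constCode⇓ k xs ∷ []) succ⇓

const : ℕ → Total n
const k = record { code = constCode k ; ⟪_⟫ = λ _ → k ; apply⇓ = constCode⇓ k }

-- Throughout, `0` means failure or "not yet" and `suc v` means success with output `v`. Under this
-- reading `guard` is a conjunction that keeps the second output, and `orElse` is a disjunction that
-- prefers the first.
guard : ℕ → ℕ → ℕ
guard zero    b = 0
guard (suc _) b = b

orElse : ℕ → ℕ → ℕ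
orElse zero    b = b
orElse (suc a) b = suc a

isZero : ℕ → ℕ
isZero zero    = 1
isZero (suc _) = 0

predᵗ isZeroᵗ : Total n → Total n
predᵗ F = withValues (primrec (const 0) (var 0F)) (λ { (x ∷ []) → pred x })
  (λ { (zero ∷ []) → refl ; (suc x ∷ []) → refl }) ∘[ F ∷ [] ]
isZeroᵗ F = withValues (primrec (const 1) (const 0)) (λ { (x ∷ []) → isZero x })
  (λ { (zero ∷ []) → refl ; (suc x ∷ []) → refl }) ∘[ F ∷ [] ]

guardᵗ orElseᵗ _∸ᵗ_ isEqᵗ : Total n → Total n → Total n
guardᵗ F G = withValues (primrec (const 0) (var 2F)) (λ { (a ∷ b ∷ []) → guard a b })
  (λ { (zero ∷ b ∷ []) → refl ; (suc a ∷ b ∷ []) → refl }) ∘[ F ∷ G ∷ [] ]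
orElseᵗ F G = withValues (primrec (var 0F) (sucᵗ (var 0F))) (λ { (a ∷ b ∷ []) → orElse a b })
  (λ { (zero ∷ b ∷ []) → refl ; (suc a ∷ b ∷ []) → refl }) ∘[ F ∷ G ∷ [] ]
F ∸ᵗ G = withValues (primrec (var 0F) (predᵗ (var 1F))) (λ { (b ∷ a ∷ []) → a ∸ b })
  (λ { (b ∷ a ∷ []) → go b a }) ∘[ G ∷ F ∷ [] ]
  where
  go : ∀ b a → ⟪ primrec (var 0F) (predᵗ (var 1F)) ⟫ (b ∷ a ∷ []) ≡ a ∸ b
  go zero    a = refl
  go (suc b) a = trans (cong pred (go b a)) (pred[m∸n]≡m∸[1+n] a b)
isEqᵗ F G = guardᵗ (isZeroᵗ (F ∸ᵗ G)) (isZeroᵗ (G ∸ᵗ F))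

isEq : ℕ → ℕ → ℕ
isEq a b = guard (isZero (a ∸ b)) (isZero (b ∸ a))

guard-suc⁻ : ∀ a {b y} → guard a b ≡ suc y → (∃ λ v → a ≡ suc v) × b ≡ suc y
guard-suc⁻ (suc a) eq = (a , refl) , eq

guard-suc⁺ : ∀ {a v b y} → a ≡ suc v → b ≡ suc y → guard a b ≡ suc y
guard-suc⁺ refl refl = refl

isZero-suc⁻ : ∀ a {y} → isZero a ≡ suc y → a ≡ 0
isZero-suc⁻ zero _ = refl

isEq-suc⁻ : ∀ a b {y} → isEq a b ≡ suc y → a ≡ b
isEq-suc⁻ a b eq with (_ , p) , q ← guard-suc⁻ (isZero (a ∸ b)) eq =
  ≤-antisym (m∸n≡0⇒m≤n (isZero-suc⁻ _ p)) (m∸n≡0⇒m≤n (isZero-suc⁻ _ q))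

isEq-refl : ∀ a → isEq a a ≡ 1
isEq-refl a rewrite n∸n≡0 a = refl

orElse-suc⁻ : ∀ a {b y} → orElse a b ≡ suc y → a ≡ suc y ⊎ b ≡ suc y
orElse-suc⁻ zero    eq = inj₂ eq
orElse-suc⁻ (suc a) eq = inj₁ eq

orElse-suc⁺ : ∀ a {b y} → b ≡ suc y → ∃ λ z → orElse a b ≡ suc z
orElse-suc⁺ zero    eq = _ , eq
orElse-suc⁺ (suc a) eq = a , refl

-- Bounded and unbounded search.

find : Total (1 + n) → Total (1 + n)
find F = primrec (const 0) (orElseᵗ (var 1F) (substFirst 2 F (var 0F ∷ [])))

module _ (F : Total (1 + n)) {xs : Vec ℕ n} where

  find-sound : ∀ k {y} → ⟪ find F ⟫ (k ∷ xs) ≡ suc y → ∃ λ j → j < k × ⟪ F ⟫ (j ∷ xs) ≡ suc y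
  find-sound (suc k) eq with orElse-suc⁻ (⟪ find F ⟫ (k ∷ xs)) eq
  ... | inj₂ here = k , ≤-refl , here
  ... | inj₁ there with j , j<k , p ← find-sound k there = j , m≤n⇒m≤1+n j<k , p

  find-complete : ∀ {k j y} → j < k → ⟪ F ⟫ (j ∷ xs) ≡ suc y → ∃ λ z → ⟪ find F ⟫ (k ∷ xs) ≡ suc z
  find-complete {suc k} (s≤s j≤k) eq with m≤n⇒m<n∨m≡n j≤k
  ... | inj₂ refl = orElse-suc⁺ (⟪ find F ⟫ (k ∷ xs)) eq
  ... | inj₁ j<k with z , p ← find-complete {k} j<k eq rewrite p = z , refl

forAllBelow : Total (1 + n) → Total (1 + n)
forAllBelow F = primrec (const 1) (guardᵗ (var 1F) (substFirst 2 F (var 0F ∷ [])))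

module _ (F : Total (1 + n)) {xs : Vec ℕ n} where

  forAllBelow-sound : ∀ k {y} → ⟪ forAllBelow F ⟫ (k ∷ xs) ≡ suc y →
    ∀ j → j < k → ∃ λ v → ⟪ F ⟫ (j ∷ xs) ≡ suc v
  forAllBelow-sound (suc k) eq j (s≤s j≤k)
    with (_ , below) , here ← guard-suc⁻ (⟪ forAllBelow F ⟫ (k ∷ xs)) eq | m≤n⇒m<n∨m≡n j≤k
  ... | inj₁ j<k  = forAllBelow-sound k below j j<k
  ... | inj₂ refl = _ , here

  forAllBelow-complete : ∀ k → (∀ j → j < k → ∃ λ v → ⟪ F ⟫ (j ∷ xs) ≡ suc v) →
    ∃ λ y → ⟪ forAllBelow F ⟫ (k ∷ xs) ≡ suc y
  forAllBelow-complete zero    h = 0 , refl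
  forAllBelow-complete (suc k) h =
    _ , guard-suc⁺ (proj₂ (forAllBelow-complete k (λ j j<k → h j (m≤n⇒m≤1+n j<k)))) (proj₂ (h k ≤-refl))

module _ (F : Total (1 + n)) where

  FirstHit : Vec ℕ n → ℕ → ℕ → Set
  FirstHit xs t y = ⟪ F ⟫ (t ∷ xs) ≡ suc y × (∀ s → s < t → ⟪ F ⟫ (s ∷ xs) ≡ 0)

  firstHit : ∀ {xs} t {v} → ⟪ F ⟫ (t ∷ xs) ≡ suc v → ∃₂ (FirstHit xs)
  firstHit {xs} t {v} hit = fromSearch (search t)
    where
    search : ∀ k → ∃₂ (FirstHit xs) ⊎ (∀ s → s < k → ⟪ F ⟫ (s ∷ xs) ≡ 0)
    search zero = inj₂ λ _ ()
    search (suc k) with search k | ⟪ F ⟫ (k ∷ xs) in eq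
    ... | inj₁ found | _     = inj₁ found
    ... | inj₂ none  | suc y = inj₁ (k , y , eq , none)
    ... | inj₂ none  | zero  = inj₂ λ { s (s≤s s≤k) → extend (m≤n⇒m<n∨m≡n s≤k) }
      where
      extend : ∀ {s} → s < k ⊎ s ≡ k → ⟪ F ⟫ (s ∷ xs) ≡ 0
      extend (inj₁ s<k)  = none _ s<k
      extend (inj₂ refl) = eq
    fromSearch : ∃₂ (FirstHit xs) ⊎ (∀ s → s < t → ⟪ F ⟫ (s ∷ xs) ≡ 0) → ∃₂ (FirstHit xs)
    fromSearch (inj₁ found) = found
    fromSearch (inj₂ none)  = t , v , hit , none

  -- `mu` looks for a zero, so it is run on `isZeroᵗ F`; `predᵗ F` then strips the success tag at
  -- the point found.
  firstCode : Code n
  firstCode = comp (code (predᵗ F)) (mu (code (isZeroᵗ F)) ∷ codes (remainingVars 0))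

  firstCode⇓ : ∀ {xs t y} → FirstHit xs t y → firstCode [ xs ]⇓ y
  firstCode⇓ {xs} {t} (hit , none) = comp⇓
    (mu⇓ (λ z z<t → 0 , isZero⇓ z (none z z<t)) (isZero⇓ t hit)
      ∷ subst (Pointwise _ _) (values-remainingVars 0 xs) (values⇓ (remainingVars 0) xs))
    (subst (code (predᵗ F) [ t ∷ xs ]⇓_) (cong pred hit) (apply⇓ (predᵗ F) _))
    where
    isZero⇓ : ∀ z {v} → ⟪ F ⟫ (z ∷ xs) ≡ v → code (isZeroᵗ F) [ z ∷ xs ]⇓ isZero v
    isZero⇓ z eq = subst (code (isZeroᵗ F) [ z ∷ xs ]⇓_) (cong isZero eq) (apply⇓ (isZeroᵗ F) _)

  firstCode⇓⁻ : ∀ {xs y} → firstCode [ xs ]⇓ y → ∃ λ t → FirstHit xs t y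
  firstCode⇓⁻ {xs} d@(comp⇓ (mu⇓ {y = t} _ e ∷ _) _) with ⟪ F ⟫ (t ∷ xs) in eq
  ... | zero  = contradiction (⇓-deterministic (code (isZeroᵗ F)) e
                  (subst (code (isZeroᵗ F) [ t ∷ xs ]⇓_) (cong isZero eq) (apply⇓ (isZeroᵗ F) _))) λ ()
  ... | suc v with t′ , y′ , first ← firstHit t eq
    with refl ← ⇓-deterministic firstCode d (firstCode⇓ first) = t′ , first

-- Stage-bounded evaluation of partial computable functions

FunctionalRel : (Vec ℕ n → ℕ → Set) → Set
FunctionalRel R = ∀ {xs y y′} → R xs y → R xs y′ → y ≡ y′

-- Every hit is correct, and a correct value persists at all later stages. Persistence lets finitely
-- many computations succeed together at the maximum of their stages.
record Enumeration {n : ℕ} (R : Vec ℕ n → ℕ → Set) : Set where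
  field
    stage      : Total (1 + n)
    sound      : ∀ t {xs y} → ⟪ stage ⟫ (t ∷ xs) ≡ suc y → R xs y
    eventually : ∀ {xs y} → R xs y → ∃ λ t → ∀ s → t ≤ s → ⟪ stage ⟫ (s ∷ xs) ≡ suc y

open Enumeration

uniformBound : {Q : ℕ → ℕ → Set} → ∀ k → (∀ z → z < k → ∃ λ t → ∀ s → t ≤ s → Q z s) →
  ∃ λ t → ∀ s → t ≤ s → ∀ z → z < k → Q z s
uniformBound zero    h = 0 , λ _ _ _ ()
uniformBound {Q} (suc k) h
  with t , p ← uniformBound {Q} k (λ z z<k → h z (m≤n⇒m≤1+n z<k)) | u , q ← h k ≤-refl =
  t ⊔ u , λ s t⊔u≤s z z<1+k → extend s t⊔u≤s (m≤n⇒m<n∨m≡n (≤-pred z<1+k))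
  where
  extend : ∀ s → t ⊔ u ≤ s → ∀ {z} → z < k ⊎ z ≡ k → Q z s
  extend s t⊔u≤s (inj₁ z<k)  = p s (m⊔n≤o⇒m≤o t u t⊔u≤s) _ z<k
  extend s t⊔u≤s (inj₂ refl) = q s (m⊔n≤o⇒n≤o t u t⊔u≤s)

module _ (F : Total (1 + n)) {R : Vec ℕ n → ℕ → Set} (R-functional : FunctionalRel R)
  (F-sound : ∀ t {xs y} → ⟪ F ⟫ (t ∷ xs) ≡ suc y → R xs y)
  (F-complete : ∀ {xs y} → R xs y → ∃ λ t → ⟪ F ⟫ (t ∷ xs) ≡ suc y)
  where

  -- The first hit of `F` need not be the one given by `F-complete`; soundness and functionality of
  -- `R` force the same output.
  hits⇒code : ∀ {xs y} → R xs y ⇔ firstCode F [ xs ]⇓ y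
  hits⇒code {xs} {y} = mk⇔ forth back
    where
    back : firstCode F [ xs ]⇓ y → R xs y
    back d with t , hit , _ ← firstCode⇓⁻ F d = F-sound t hit
    forth : R xs y → firstCode F [ xs ]⇓ y
    forth r with t , hit ← F-complete r with t′ , y′ , first ← firstHit F t hit
      with refl ← R-functional r (F-sound t′ (proj₁ first)) = firstCode⇓ F first

totalEnumeration : (F : Total n) → Enumeration (code F [_]⇓_)
totalEnumeration F = record
  { stage      = substFirst 1 (sucᵗ F) []
  ; sound      = λ { t {xs} refl → apply⇓ F xs }
  ; eventually = λ {xs} d → 0 , λ _ _ → cong suc (⇓-deterministic (code F) (apply⇓ F xs) d)
  }

allDefined : Vec (Total n) m → Total n
allDefined []       = const 1
allDefined (F ∷ Fs) = guardᵗ F (allDefined Fs)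

module _ {n : ℕ} where

  stages : {gs : Vec (Code n) m} → All (λ g → Enumeration (g [_]⇓_)) gs → Vec (Total (1 + n)) m
  stages []       = []
  stages (e ∷ es) = stage e ∷ stages es

  stages-sound : {gs : Vec (Code n) m} (es : All (λ g → Enumeration (g [_]⇓_)) gs) →
    ∀ t {xs v} → ⟪ allDefined (stages es) ⟫ (t ∷ xs) ≡ suc v →
    Pointwise (λ g y → g [ xs ]⇓ y) gs (values (map predᵗ (stages es)) (t ∷ xs))
  stages-sound [] t _ = []
  stages-sound {gs = g ∷ _} (e ∷ es) t {xs} defined
    with (v , here) , there ← guard-suc⁻ (⟪ stage e ⟫ (t ∷ xs)) defined =
    subst (g [ xs ]⇓_) (cong pred (sym here)) (sound e t here) ∷ stages-sound es t there

  stages-eventually : {gs : Vec (Code n) m} (es : All (λ g → Enumeration (g [_]⇓_)) gs) →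
    ∀ {xs ys} → Pointwise (λ g y → g [ xs ]⇓ y) gs ys → ∃ λ t → ∀ s → t ≤ s →
    (∃ λ v → ⟪ allDefined (stages es) ⟫ (s ∷ xs) ≡ suc v) ×
    values (map predᵗ (stages es)) (s ∷ xs) ≡ ys
  stages-eventually [] [] = 0 , λ _ _ → (0 , refl) , refl
  stages-eventually (e ∷ es) (d ∷ ds)
    with t , p ← eventually e d | u , q ← stages-eventually es ds =
    t ⊔ u , λ s t⊔u≤s →
      let here                    = p s (m⊔n≤o⇒m≤o t u t⊔u≤s)
          (v , defined) , outputs = q s (m⊔n≤o⇒n≤o t u t⊔u≤s)
      in (v , guard-suc⁺ here defined) , cong₂ _∷_ (cong pred here) outputs

  compEnumeration : (f : Code m) (gs : Vec (Code n) m) → Enumeration (f [_]⇓_) →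
    All (λ g → Enumeration (g [_]⇓_)) gs → Enumeration (comp f gs [_]⇓_)
  compEnumeration f gs e es = record
    { stage      = guardᵗ (allDefined (stages es)) (stage e ∘[ var 0F ∷ map predᵗ (stages es) ])
    ; sound      = λ t {xs} eq →
        let (_ , defined) , outer = guard-suc⁻ (⟪ allDefined (stages es) ⟫ (t ∷ xs)) eq
        in comp⇓ (stages-sound es t defined) (sound e t outer)
    ; eventually = λ { (comp⇓ ds d) →
        let t , p = stages-eventually es ds
            u , q = eventually e d
        in t ⊔ u , λ s t⊔u≤s →
          let (_ , defined) , outputs = p s (m⊔n≤o⇒m≤o t u t⊔u≤s)
          in guard-suc⁺ defined (trans (cong (λ ys → ⟪ stage e ⟫ (s ∷ ys)) outputs)
                                       (q s (m⊔n≤o⇒n≤o t u t⊔u≤s))) }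
    }

  precEnumeration : (f : Code n) (g : Code (2 + n)) → Enumeration (f [_]⇓_) →
    Enumeration (g [_]⇓_) → Enumeration (prec f g [_]⇓_)
  precEnumeration f g ef eg = record
    -- `iterate` recurses on the argument `k` with the stage as a parameter, whereas a `stage` takes
    -- the stage first; hence the exchange.
    { stage      = substFirst 2 iterate (var 1F ∷ var 0F ∷ [])
    ; sound      = λ { t {k ∷ xs} eq → iterate-sound t k eq }
    ; eventually = iterate-eventually
    }
    where
    iterate : Total (2 + n)
    iterate = primrec (stage ef)
      (guardᵗ (var 1F) (substFirst 3 (stage eg) (var 2F ∷ var 0F ∷ predᵗ (var 1F) ∷ [])))

    iterate-sound : ∀ t k {xs y} → ⟪ iterate ⟫ (k ∷ t ∷ xs) ≡ suc y → prec f g [ k ∷ xs ]⇓ y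
    iterate-sound t zero    eq = prec₀ (sound ef t eq)
    iterate-sound t (suc k) {xs} eq
      with (v , before) , step ← guard-suc⁻ (⟪ iterate ⟫ (k ∷ t ∷ xs)) eq =
      prec₊ (iterate-sound t k before)
        (sound eg t (trans (cong (λ w → ⟪ stage eg ⟫ (t ∷ k ∷ pred w ∷ xs)) (sym before)) step))

    iterate-eventually : ∀ {xs y} → prec f g [ xs ]⇓ y → ∃ λ t → ∀ s → t ≤ s →
      ⟪ substFirst 2 iterate (var 1F ∷ var 0F ∷ []) ⟫ (s ∷ xs) ≡ suc y
    iterate-eventually (prec₀ d) = eventually ef d
    iterate-eventually (prec₊ {k = k} {xs = xs} d e)
      with t , p ← iterate-eventually d | u , q ← eventually eg e =
      t ⊔ u , λ s t⊔u≤s →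
        let before = p s (m⊔n≤o⇒m≤o t u t⊔u≤s)
        in guard-suc⁺ before (trans (cong (λ w → ⟪ stage eg ⟫ (s ∷ k ∷ pred w ∷ xs)) before)
                                    (q s (m⊔n≤o⇒n≤o t u t⊔u≤s)))

  muEnumeration : (f : Code (1 + n)) → Enumeration (f [_]⇓_) → Enumeration (mu f [_]⇓_)
  muEnumeration f e = record
    { stage      = substFirst 1 (find test) (var 0F ∷ var 0F ∷ [])
    ; sound      = search-sound
    ; eventually = search-eventually
    }
    where
    inner test : Total (2 + n)
    inner = substFirst 2 (stage e) (var 1F ∷ var 0F ∷ [])
    -- A value `suc v` shows as `suc (suc v)`, so a positive predecessor says that the value has
    -- been found and is nonzero. The output `suc j` reports the zero `j`.
    test  = guardᵗ (forAllBelow (predᵗ inner))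
              (guardᵗ inner (guardᵗ (isZeroᵗ (predᵗ inner)) (sucᵗ (var 0F))))

    pred-suc⁻ : ∀ a {v} → pred a ≡ suc v → a ≡ suc (suc v)
    pred-suc⁻ (suc a) refl = refl

    search-sound : ∀ t {xs y} → ⟪ find test ⟫ (t ∷ t ∷ xs) ≡ suc y → mu f [ xs ]⇓ y
    search-sound t {xs} {y} eq
      with j , _ , found ← find-sound test t eq
      with (_ , below) , rest ← guard-suc⁻ (⟪ forAllBelow (predᵗ inner) ⟫ (j ∷ t ∷ xs)) found
      with (v , here) , rest′ ← guard-suc⁻ (⟪ stage e ⟫ (t ∷ j ∷ xs)) rest
      with (_ , isZ) , refl ← guard-suc⁻ (isZero (pred (⟪ stage e ⟫ (t ∷ j ∷ xs)))) rest′ =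
      mu⇓ (λ z z<j → let w , p = forAllBelow-sound (predᵗ inner) j below z z<j
                     in w , sound e t (pred-suc⁻ _ p))
          (sound e t (trans here (cong suc (trans (cong pred (sym here)) (isZero-suc⁻ _ isZ)))))

    search-eventually : ∀ {xs y} → mu f [ xs ]⇓ y → ∃ λ t → ∀ s → t ≤ s →
      ⟪ find test ⟫ (s ∷ s ∷ xs) ≡ suc y
    search-eventually {xs} {y} μ@(mu⇓ h d)
      with t , p ← uniformBound {Q = λ z s → ∃ λ v → ⟪ stage e ⟫ (s ∷ z ∷ xs) ≡ suc (suc v)} y
                        (λ z z<y → let v , dz = h z z<y ; t , p = eventually e dz in t , λ s t≤s → v , p s t≤s)
         | u , q ← eventually e d =
      -- The search only visits points below the stage, so the stage must exceed `y`.
      suc y ⊔ (t ⊔ u) , λ s bound →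
        let t⊔u≤s = m⊔n≤o⇒n≤o (suc y) (t ⊔ u) bound
            here  = q s (m⊔n≤o⇒n≤o t u t⊔u≤s)
            found = guard-suc⁺
              (proj₂ (forAllBelow-complete (predᵗ inner) y
                (λ j j<y → _ , cong pred (proj₂ (p s (m⊔n≤o⇒m≤o t u t⊔u≤s) j j<y)))))
              (guard-suc⁺ here (guard-suc⁺ (cong (isZero ∘ pred) here) refl))
            z , hit = find-complete test (m⊔n≤o⇒m≤o (suc y) (t ⊔ u) bound) found
        in trans hit (cong suc (⇓-deterministic (mu f) (search-sound s hit) μ))

mutual
  enumerate : (c : Code n) → Enumeration (c [_]⇓_)
  enumerate zer         = totalEnumeration zeroᵗ
  enumerate succ        = totalEnumeration successor
  enumerate (proj i)    = totalEnumeration (var i)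
  enumerate (comp f gs) = compEnumeration f gs (enumerate f) (enumerateAll gs)
  enumerate (prec f g)  = precEnumeration f g (enumerate f) (enumerate g)
  enumerate (mu f)      = muEnumeration f (enumerate f)

  enumerateAll : (gs : Vec (Code n) m) → All (λ g → Enumeration (g [_]⇓_)) gs
  enumerateAll []       = []
  enumerateAll (g ∷ gs) = enumerate g ∷ enumerateAll gs

enumerate-𝓟 : {p : PFun n} → p ∈ 𝓟 → Enumeration (graph p)
enumerate-𝓟 (c , p⇔c) = record
  { stage      = stage (enumerate c)
  ; sound      = λ t eq → from (p⇔c _ _) (sound (enumerate c) t eq)
  ; eventually = λ r → eventually (enumerate c) (to (p⇔c _ _) r)
  }

-- Passage between `Total` and `𝓡`.

fromTotal : (F : Total 1) → total 1 (λ x → ⟪ F ⟫ (x ∷ [])) ∈ 𝓡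
fromTotal F = (code F , λ { (x ∷ []) y → mk⇔
    (λ eq → subst (code F [ x ∷ [] ]⇓_) eq (apply⇓ F _))
    (⇓-deterministic (code F) (apply⇓ F _)) })
  , λ { (x ∷ []) → _ , refl }

fromTotal₂ : (F : Total 2) → total 2 (λ x y → ⟪ F ⟫ (x ∷ y ∷ [])) ∈ 𝓡
fromTotal₂ F = (code F , λ { (x ∷ y ∷ []) z → mk⇔
    (λ eq → subst (code F [ x ∷ y ∷ [] ]⇓_) eq (apply⇓ F _))
    (⇓-deterministic (code F) (apply⇓ F _)) })
  , λ { (x ∷ y ∷ []) → _ , refl }

toTotal : {f : ℕ → ℕ} → total 1 f ∈ 𝓡 → Total 1
toTotal {f} ((c , f⇔c) , _) = record
  { code   = c
  ; ⟪_⟫    = λ { (x ∷ []) → f x }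
  ; apply⇓ = λ { (x ∷ []) → to (f⇔c _ _) refl }
  }

toTotal₂ : {f : ℕ → ℕ → ℕ} → total 2 f ∈ 𝓡 → Total 2
toTotal₂ {f} ((c , f⇔c) , _) = record
  { code   = c
  ; ⟪_⟫    = λ { (x ∷ y ∷ []) → f x y }
  ; apply⇓ = λ { (x ∷ y ∷ []) → to (f⇔c _ _) refl }
  }

∘∈𝓡 : {f g : ℕ → ℕ} → total 1 f ∈ 𝓡 → total 1 g ∈ 𝓡 → total 1 (f ∘ g) ∈ 𝓡
∘∈𝓡 f∈𝓡 g∈𝓡 = fromTotal (toTotal f∈𝓡 ∘[ toTotal g∈𝓡 ∷ [] ])

-- Computable decoding of pairs.

module PairingProperties (π : Pairing) where
  open Pairing π

  ⟨⟩-injective : ∀ {a b c d} → ⟨ a , b ⟩ ≡ ⟨ c , d ⟩ → a ≡ c × b ≡ d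
  ⟨⟩-injective eq with refl ← proj₁ bijective eq = refl , refl

  left right : ℕ → ℕ
  left  z = proj₁ (proj₁ (proj₂ bijective z))
  right z = proj₂ (proj₁ (proj₂ bijective z))

  ⟨left,right⟩ : ∀ z → ⟨ left z , right z ⟩ ≡ z
  ⟨left,right⟩ z = proj₂ (proj₂ bijective z) refl

  left-⟨⟩ : ∀ a b → left ⟨ a , b ⟩ ≡ a
  left-⟨⟩ a b = proj₁ (⟨⟩-injective (⟨left,right⟩ ⟨ a , b ⟩))

  right-⟨⟩ : ∀ a b → right ⟨ a , b ⟩ ≡ b
  right-⟨⟩ a b = proj₂ (⟨⟩-injective (⟨left,right⟩ ⟨ a , b ⟩))

  pairᵗ : Total n → Total n → Total n
  pairᵗ F G = toTotal₂ computable ∘[ F ∷ G ∷ [] ]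

  private
    decoding : ℕ → Vec ℕ 3
    decoding z = right z ∷ left z ∷ z ∷ []

    -- Both components of `z` are at most `z`, so a double search bounded by `suc z` finds them.
    -- `decoding z` lists the variables of `test` at the successful pair, and `out` selects the one
    -- to return.
    component : Fin 3 → Total 1
    component out = withValues (predᵗ (find outer ∘[ sucᵗ (var 0F) ∷ var 0F ∷ [] ]))
        (λ { (z ∷ []) → lookup (decoding z) out }) (λ { (z ∷ []) → correct z })
      where
      test : Total 3
      test = guardᵗ (isEqᵗ (pairᵗ (var 1F) (var 0F)) (var 2F)) (sucᵗ (var out))
      outer : Total 2
      outer = find test ∘[ sucᵗ (var 1F) ∷ var 0F ∷ var 1F ∷ [] ]

      correct : ∀ z → pred (⟪ find outer ⟫ (suc z ∷ z ∷ [])) ≡ lookup (decoding z) out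
      correct z
        with _ , hit  ← find-complete test {left z ∷ z ∷ []} {suc z} {right z}
               (s≤s (subst (right z ≤_) (⟨left,right⟩ z) (≥-right (left z) (right z))))
               (guard-suc⁺ (trans (cong (λ a → isEq a z) (⟨left,right⟩ z)) (isEq-refl z)) refl)
        with w , hit′ ← find-complete outer {z ∷ []} {suc z} {left z}
               (s≤s (subst (left z ≤_) (⟨left,right⟩ z) (≥-left (left z) (right z)))) hit
        with a , _ , inner ← find-sound outer (suc z) hit′
        with b , _ , tested ← find-sound test (suc z) inner
        with (_ , same) , found ← guard-suc⁻ (isEq ⟨ a , b ⟩ z) tested
        with refl , refl ← ⟨⟩-injective (trans (isEq-suc⁻ _ _ same) (sym (⟨left,right⟩ z))) =
        cong pred (trans hit′ (sym found))

  leftᵗ rightᵗ : Total n → Total n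
  leftᵗ  F = component 1F ∘[ F ∷ [] ]
  rightᵗ F = component 0F ∘[ F ∷ [] ]

-- The partial functions are explicit because _≈_ unfolds to a type from which
-- they cannot be inferred.
≈-sym : (p q : PFun n) → p ≈ q → q ≈ p
≈-sym p q = IsEquivalence.sym ≈-isEquivalence {p} {q}

≈-trans : (p q r : PFun n) → p ≈ q → q ≈ r → p ≈ r
≈-trans p q r = IsEquivalence.trans ≈-isEquivalence {p} {q} {r}

𝓟-resp-≈ : ∀ (p q : PFun n) → p ≈ q → p ∈ 𝓟 → q ∈ 𝓟
𝓟-resp-≈ p q p≈q (c , p⇔c) = c , λ xs y →
  mk⇔ (to (p⇔c xs y) ∘ from (p≈q xs y)) (to (p≈q xs y) ∘ from (p⇔c xs y))

-- Decidability and stability on `𝓢 A`.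

module _ {A : Pred ℕ 0ℓ} where

  𝓢-dom? : ∀ p → p ∈ 𝓢 A → ∀ x → Dec (Dom p x)
  𝓢-dom? p (inj₁ (_ , p-total))        x = yes (p-total _)
  𝓢-dom? p (inj₂ (inj₁ (dom⊆∅ , _)))   x = no dom⊆∅
  𝓢-dom? p (inj₂ (inj₂ (a , _ , dom⊆ , ⊆dom))) x with x <? a
  ... | yes x<a = yes (⊆dom x<a)
  ... | no  x≮a = no (x≮a ∘ dom⊆)

  𝓢-graph? : ∀ p → p ∈ 𝓢 A → ∀ x y → Dec (graph p (x ∷ []) y)
  𝓢-graph? p p∈𝓢 x y with 𝓢-dom? p p∈𝓢 x
  ... | no  ¬def       = no λ g → ¬def (y , g)
  ... | yes (z , g) with z ≟ y
  ...   | yes refl = yes g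
  ...   | no  z≢y  = no λ g′ → z≢y (functional p g g′)

  𝓢-≈-stable : ∀ p q → p ∈ 𝓢 A → q ∈ 𝓢 A →
    (∀ x y → ¬ ¬ (graph p (x ∷ []) y ⇔ graph q (x ∷ []) y)) → p ≈ q
  𝓢-≈-stable p q p∈𝓢 q∈𝓢 ¬¬p≈q (x ∷ []) y = mk⇔
    (λ g → decidable-stable (𝓢-graph? q q∈𝓢 x y) λ ¬g → ¬¬p≈q x y λ e → ¬g (to e g))
    (λ g → decidable-stable (𝓢-graph? p p∈𝓢 x y) λ ¬g → ¬¬p≈q x y λ e → ¬g (from e g))

-- If no member exceeded `x`, the finite list `upTo (suc x)` would contain all of `A`.
infinite⇒¬¬unbounded : {A : Pred ℕ 0ℓ} → Infinite A → ∀ x → ¬ ¬ ∃ λ a → a ∈ A × x < a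
infinite⇒¬¬unbounded A-infinite x bounded =
  A-infinite (upTo (suc x) , λ {a} a∈A → ∈-upTo⁺ (s≤s (≮⇒≥ λ x<a → bounded (a , a∈A , x<a))))

-- The retraction

module Retraction
  (π : Pairing) (A : Pred ℕ 0ℓ) (A-infinite : Infinite A)
  (α : ℕ → ℕ) (α∈𝓡 : total 1 α ∈ 𝓡) (A≐α : A ≐ Range α)
  (θ : Numbering (𝓢 A)) (θ-qg : IsQuasiGödel π A θ)
  (φ : Numbering 𝓟) (φ-gödel : IsGödel φ) where

  open Pairing π
  open PairingProperties π
  open ExtendedGraph π
  open IsQuasiGödel θ-qg
  open IsGödel φ-gödel

  θ∈𝓢 : ∀ j → θ at j ∈ 𝓢 A
  θ∈𝓢 j = proj₂ (Surjection.to θ j)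

  φ∈𝓟 : ∀ i → φ at i ∈ 𝓟
  φ∈𝓟 i = proj₂ (Surjection.to φ i)

  φ-index : ∀ p → p ∈ 𝓟 → ∃ λ i → φ at i ≈ p
  φ-index p p∈𝓟 with i , e ← Surjection.surjective φ (p , p∈𝓟) = i , e refl

  universalStages : Enumeration (graph (universal φ))
  universalStages = enumerate-𝓟 {p = universal φ} universal∈𝓟

  U : Total 3
  U = stage universalStages

  γ : ℕ → ℕ
  γ = proj₁ QGN-I

  γᵗ : Total n → Total n
  γᵗ F = toTotal (proj₁ (proj₂ QGN-I)) ∘[ F ∷ [] ]

  γ-sound : ∀ {t i x y} → γ t ≡ ⟨ ⟨ i , x ⟩ , suc y ⟩ → graph (θ at i) (x ∷ []) y
  γ-sound {t} eq with proj₂ (proj₂ (proj₂ QGN-I)) (t , eq)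
  ... | inj₁ (_ , _ , eq′) = contradiction (proj₂ (⟨⟩-injective eq′)) λ ()
  ... | inj₂ (_ , _ , _ , g , eq′)
    with eqₗ , refl ← ⟨⟩-injective eq′ with refl , refl ← ⟨⟩-injective eqₗ = g

  γ-complete : ∀ {i x y} → graph (θ at i) (x ∷ []) y → ∃ λ t → γ t ≡ ⟨ ⟨ i , x ⟩ , suc y ⟩
  γ-complete g = proj₁ (proj₂ (proj₂ QGN-I)) (inj₂ (_ , _ , _ , g , refl))

  abstract
    universal-θ∈𝓟 : universal θ ∈ 𝓟
    universal-θ∈𝓟 = firstCode F , λ xs y →
      hits⇒code F {graph (universal θ)} (λ {xs} → functional (universal θ) {xs})
        (λ t {xs} → F-sound t {xs}) (λ {xs} → F-complete {xs})
      where
      F : Total 3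
      -- The second entry of a pair in the extended graph is `0` or `suc y`, which is already the
      -- convention for a miss or a hit.
      F = guardᵗ (isEqᵗ (leftᵗ (γᵗ (var 0F))) (pairᵗ (var 1F) (var 2F))) (rightᵗ (γᵗ (var 0F)))
      F-sound : ∀ t {xs y} → ⟪ F ⟫ (t ∷ xs) ≡ suc y → graph (universal θ) xs y
      F-sound t {i ∷ x ∷ []} eq
        with (_ , same) , out ← guard-suc⁻ (isEq (left (γ t)) ⟨ i , x ⟩) eq =
        γ-sound (trans (sym (⟨left,right⟩ (γ t))) (cong₂ ⟨_,_⟩ (isEq-suc⁻ _ _ same) out))
      F-complete : ∀ {xs y} → graph (universal θ) xs y → ∃ λ t → ⟪ F ⟫ (t ∷ xs) ≡ suc y
      F-complete {i ∷ x ∷ []} {y} g with t , eq ← γ-complete g = t , guard-suc⁺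
        (trans (cong (λ a → isEq a ⟨ i , x ⟩) (trans (cong left eq) (left-⟨⟩ _ _))) (isEq-refl ⟨ i , x ⟩))
        (trans (cong right eq) (right-⟨⟩ _ _))

  θ≤ₘφ : θ ≤ₘ φ
  θ≤ₘφ with g , g∈𝓡 , e ← smn (universal θ) universal-θ∈𝓟 =
    g , g∈𝓡 , λ i → ≈-sym (φ at g i) (section (universal θ) i) (e i)

  -- No code is built by hand for the members of `Anf A`: surjectivity of `θ` gives an index, and
  -- `θ≤ₘφ` carries it to `φ`.
  𝓢⊆𝓟 : 𝓢 A ⊆ 𝓟
  𝓢⊆𝓟 {p} p∈𝓢 with j , e ← Surjection.surjective θ (p , p∈𝓢) =
    𝓟-resp-≈ (φ at proj₁ θ≤ₘφ j) p
      (≈-trans (φ at proj₁ θ≤ₘφ j) (θ at j) p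
        (≈-sym (θ at j) (φ at proj₁ θ≤ₘφ j) (proj₂ (proj₂ θ≤ₘφ) j)) (e refl))
      (φ∈𝓟 (proj₁ θ≤ₘφ j))

  -- Stage 0 is empty, so that the value 0 of an unfinished computation
  -- contributes every ⟨ y , 0 ⟩ of the extended graph.
  delayed : Total 3
  delayed = primrec (const 0) (U ∘[ var 0F ∷ var 2F ∷ var 3F ∷ [] ])

  extGraphEnum : Total 2
  -- The second argument codes a stage and a point; the stage output is directly the second entry of
  -- a pair in the extended graph.
  extGraphEnum = pairᵗ (rightᵗ (var 1F))
    (delayed ∘[ leftᵗ (var 1F) ∷ var 0F ∷ rightᵗ (var 1F) ∷ [] ])

  extGraphEnum-range : ∀ i → Range (λ t → ⟪ extGraphEnum ⟫ (i ∷ t ∷ [])) ≐ ExtGraph₁ (φ at i)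
  extGraphEnum-range i = (λ { (t , refl) → inGraph t }) , inRange
    where
    delayed-sound : ∀ t {x y} → ⟪ delayed ⟫ (t ∷ i ∷ x ∷ []) ≡ suc y → graph (φ at i) (x ∷ []) y
    delayed-sound (suc t) eq = sound universalStages t eq

    inGraph : ∀ t → ExtGraph₁ (φ at i) (⟪ extGraphEnum ⟫ (i ∷ t ∷ []))
    inGraph t with ⟪ delayed ⟫ (left t ∷ i ∷ right t ∷ []) in eq
    ... | zero  = inj₁ (right t , refl)
    ... | suc y = inj₂ (right t , y , delayed-sound (left t) eq , refl)

    at-⟨⟩ : ∀ t x → ⟪ extGraphEnum ⟫ (i ∷ ⟨ t , x ⟩ ∷ []) ≡ ⟨ x , ⟪ delayed ⟫ (t ∷ i ∷ x ∷ []) ⟩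
    at-⟨⟩ t x rewrite left-⟨⟩ t x | right-⟨⟩ t x = refl

    inRange : ExtGraph₁ (φ at i) ⊆ Range (λ t → ⟪ extGraphEnum ⟫ (i ∷ t ∷ []))
    inRange (inj₁ (y , refl)) = ⟨ 0 , y ⟩ , at-⟨⟩ 0 y
    inRange (inj₂ (x , y , g , refl)) with t , p ← eventually universalStages {i ∷ x ∷ []} g =
      ⟨ suc t , x ⟩ , trans (at-⟨⟩ (suc t) x) (cong ⟨ x ,_⟩ (p t ≤-refl))

  -- Translation of `φ`-indices into `θ`-indices, and self-reference.

  abstract
    translation : ∃ λ w → total 1 w ∈ 𝓡 × (∀ i → φ at i ∈ 𝓢 A → φ at i ≈ θ at (w i))
    translation =
      let w , w∈𝓡 , e = QGN-II _ (fromTotal₂ extGraphEnum)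
      in w , w∈𝓡 , λ i φᵢ∈𝓢 → e i (φ at i) φᵢ∈𝓢 (extGraphEnum-range i)

  toθ : ℕ → ℕ
  toθ = proj₁ translation

  toθ∈𝓡 : total 1 toθ ∈ 𝓡
  toθ∈𝓡 = proj₁ (proj₂ translation)

  φ≈θ∘toθ : ∀ i → φ at i ∈ 𝓢 A → φ at i ≈ θ at (toθ i)
  φ≈θ∘toθ = proj₂ (proj₂ translation)

  -- Kleene's recursion theorem for constant functions that consult their own `θ`-index. `s i`
  -- indexes the constant `c (toθ-index)` with that index computed as `φ i` at `i`; taking for `i`
  -- an index `u` of `toθ ∘ s` makes it `toθ (s u)`, so `e = s u` works.
  selfReference : (c : Code 1) → ∃ λ e → ∀ x y → graph (φ at e) (x ∷ []) y ⇔ c [ toθ e ∷ [] ]⇓ y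
  selfReference c = s u , λ x y → mk⇔ (forth ∘ to (s-spec u (x ∷ []) y))
    (λ d → from (s-spec u (x ∷ []) y) (comp⇓ (comp⇓ (proj⇓ _ ∷ proj⇓ _ ∷ []) diagonal⇓ ∷ []) d))
    where
    c-at-diagonal : Code 2
    c-at-diagonal = comp c (comp (proj₁ universal∈𝓟) (proj 0F ∷ proj 0F ∷ []) ∷ [])

    smn-c  = smn (codeFun c-at-diagonal) (codeFun∈𝓟 c-at-diagonal)
    s      = proj₁ smn-c
    s-spec = proj₂ (proj₂ smn-c)
    self   = φ-index (total 1 (toθ ∘ s)) (proj₁ (∘∈𝓡 toθ∈𝓡 (proj₁ (proj₂ smn-c))))
    u      = proj₁ self

    diagonal⇓ : proj₁ universal∈𝓟 [ u ∷ u ∷ [] ]⇓ toθ (s u)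
    diagonal⇓ = to (proj₂ universal∈𝓟 (u ∷ u ∷ []) _) (from (proj₂ self (u ∷ []) _) refl)

    forth : ∀ {x y} → c-at-diagonal [ u ∷ x ∷ [] ]⇓ y → c [ toθ (s u) ∷ [] ]⇓ y
    forth {y = y} (comp⇓ (comp⇓ (proj⇓ _ ∷ proj⇓ _ ∷ []) d ∷ []) d′) =
      subst (λ j → c [ j ∷ [] ]⇓ y) (⇓-deterministic (proj₁ universal∈𝓟) d diagonal⇓) d′

  -- Write j = toθ e. The self-referential constant function φ e takes the value 0
  -- if a nonzero value of F is found no later than θ j 0 = 0 is enumerated, and
  -- the value 1 otherwise. As φ e = θ j once either event occurs, the second can
  -- never win the race; and whether θ j 0 is defined is decidable.
  module Markov (F : Total 1) where

    race : Total 2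
    -- `orElseᵗ` lets `F` win ties. The tags `1` and `2` encode the outputs 0 and 1, and
    -- `⟨ ⟨ j , 0 ⟩ , 1 ⟩` is the entry for `θ j` being 0 at 0.
    race = orElseᵗ (guardᵗ (F ∘[ var 0F ∷ [] ]) (const 1))
      (guardᵗ (isEqᵗ (γᵗ (var 0F)) (pairᵗ (pairᵗ (var 1F) (const 0)) (const 1))) (const 2))

    abstract
      racer : ∃ λ e → ∀ x y → graph (φ at e) (x ∷ []) y ⇔ firstCode race [ toθ e ∷ [] ]⇓ y
      racer = selfReference (firstCode race)

    e j : ℕ
    e = proj₁ racer
    j = toθ e

    race-suc⁻ : ∀ t {y} → ⟪ race ⟫ (t ∷ j ∷ []) ≡ suc y →
      (∃ λ v → ⟪ F ⟫ (t ∷ []) ≡ suc v × y ≡ 0) ⊎ (γ t ≡ ⟨ ⟨ j , 0 ⟩ , 1 ⟩ × y ≡ 1)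
    race-suc⁻ t eq with orElse-suc⁻ (guard (⟪ F ⟫ (t ∷ [])) 1) eq
    ... | inj₁ F-wins with (v , hit) , refl ← guard-suc⁻ (⟪ F ⟫ (t ∷ [])) F-wins = inj₁ (v , hit , refl)
    ... | inj₂ γ-wins with (_ , same) , refl ← guard-suc⁻ (isEq (γ t) ⟨ ⟨ j , 0 ⟩ , 1 ⟩) γ-wins =
      inj₂ (isEq-suc⁻ _ _ same , refl)

    θⱼ-value : ∀ {t y} → FirstHit race (j ∷ []) t y → graph (θ at j) (0 ∷ []) y
    θⱼ-value {y = y} first = to (φ≈θ∘toθ e φₑ∈𝓢 (0 ∷ []) y) (value 0)
      where
      value : ∀ x → graph (φ at e) (x ∷ []) y
      value x = from (proj₂ racer x y) (firstCode⇓ race first)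
      φₑ∈𝓢 : φ at e ∈ 𝓢 A
      -- Whoever wins, `φ e` is a total constant and hence in `𝓢 A`, which is what the translation
      -- requires.
      φₑ∈𝓢 = inj₁ (φ∈𝓟 e , λ { (x ∷ []) → y , value x })

    F-wins : ∀ t {y} → ⟪ race ⟫ (t ∷ j ∷ []) ≡ suc y →
      (∃₂ λ t v → ⟪ F ⟫ (t ∷ []) ≡ suc v) × graph (θ at j) (0 ∷ []) 0
    F-wins t hit with t′ , y , first ← firstHit race {j ∷ []} t hit with race-suc⁻ t′ (proj₁ first)
    ... | inj₁ (v , F-hit , refl) = (t′ , v , F-hit) , θⱼ-value first
    -- The enumerated entry says that `θ j` is 0 at 0, while this win gives `φ e`, hence `θ j`, the
    -- value 1.
    ... | inj₂ (γ-hit , refl) =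
      contradiction (functional (θ at j) (γ-sound γ-hit) (θⱼ-value first)) λ ()

    F-hit⇒θⱼ≡0 : (∃₂ λ t v → ⟪ F ⟫ (t ∷ []) ≡ suc v) → graph (θ at j) (0 ∷ []) 0
    F-hit⇒θⱼ≡0 (t , v , hit) with ⟪ race ⟫ (t ∷ j ∷ []) in eq
    ... | suc y = proj₂ (F-wins t eq)
    ... | zero  = contradiction (trans (sym eq)
      (cong (λ a → orElse (guard a 1) (guard (isEq (γ t) ⟨ ⟨ j , 0 ⟩ , 1 ⟩) 2)) hit)) λ ()

    markov : ¬ ¬ (∃₂ λ t v → ⟪ F ⟫ (t ∷ []) ≡ suc v) → ∃₂ λ t v → ⟪ F ⟫ (t ∷ []) ≡ suc v
    -- If `θ j` is undefined or nonzero at 0, `F` has no hit. If it is 0, `γ` enumerates this and so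
    -- ends the race, and any ended race yields a hit of `F`.
    markov ¬¬hit with 𝓢-dom? (θ at j) (θ∈𝓢 j) 0
    ... | no  undefined   = ⊥-elim (¬¬hit λ hit → undefined (0 , F-hit⇒θⱼ≡0 hit))
    ... | yes (suc y , g) = ⊥-elim (¬¬hit λ hit →
      contradiction (functional (θ at j) g (F-hit⇒θⱼ≡0 hit)) λ ())
    ... | yes (zero , g) with t , eq ← γ-complete g = proj₁ (F-wins t (proj₂
      (orElse-suc⁺ (guard (⟪ F ⟫ (t ∷ [])) 1)
        (guard-suc⁺ (trans (cong (λ a → isEq a ⟨ ⟨ j , 0 ⟩ , 1 ⟩) eq) (isEq-refl ⟨ ⟨ j , 0 ⟩ , 1 ⟩)) refl))))

  φ-dom-stable : ∀ i x → ¬ ¬ Dom (φ at i) x → Dom (φ at i) x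
  φ-dom-stable i x ¬¬def with t , v , hit ← Markov.markov (U ∘[ var 0F ∷ const i ∷ const x ∷ [] ])
      (λ noHit → ¬¬def λ { (y , g) →
        let t , p = eventually universalStages {i ∷ x ∷ []} g in noHit (t , y , p t ≤-refl) }) =
    v , sound universalStages t hit

  -- The restriction to initial segments with length in `A`.

  restricted : PFun 2
  restricted = record
    { graph      = λ { (i ∷ x ∷ []) y → graph (φ at i) (x ∷ []) y ×
                       ∃ λ t → x < α t × (∀ z → z < α t → Dom (φ at i) z) }
    ; functional = λ { {i ∷ x ∷ []} (g , _) (g′ , _) → functional (φ at i) g g′ }
    }

  abstract
    restricted∈𝓟 : restricted ∈ 𝓟
    restricted∈𝓟 = firstCode R , λ xs y →
      hits⇒code R {graph restricted} (λ {xs} → functional restricted {xs})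
        (λ t {xs} → R-sound t {xs}) (λ {xs} → R-complete {xs})
      where
      a : Total 3
      a = toTotal α∈𝓡 ∘[ leftᵗ (var 0F) ∷ [] ]

      definedAt : Total 3
      definedAt = U ∘[ var 1F ∷ var 2F ∷ var 0F ∷ [] ]

      R : Total 3
      -- The counter codes an `n` and a stage. The difference `α n ∸ x` is positive exactly when
      -- `x < α n`.
      R = guardᵗ (a ∸ᵗ var 2F)
        (guardᵗ (forAllBelow definedAt ∘[ a ∷ rightᵗ (var 0F) ∷ var 1F ∷ [] ])
          (U ∘[ rightᵗ (var 0F) ∷ var 1F ∷ var 2F ∷ [] ]))

      R-sound : ∀ t {xs y} → ⟪ R ⟫ (t ∷ xs) ≡ suc y → graph restricted xs y
      R-sound t {i ∷ x ∷ []} eq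
        with (_ , below) , rest ← guard-suc⁻ (α (left t) ∸ x) eq
        with (_ , all) , value ← guard-suc⁻ (⟪ forAllBelow definedAt ⟫ (α (left t) ∷ right t ∷ i ∷ [])) rest =
        sound universalStages (right t) value
          , left t
          , ≰⇒> (λ a≤x → contradiction (trans (sym (m≤n⇒m∸n≡0 a≤x)) below) λ ())
          , λ z z<a → let v , def = forAllBelow-sound definedAt (α (left t)) all z z<a
                      in v , sound universalStages (right t) def

      positive : ∀ {k l} → k < l → ∃ λ v → l ∸ k ≡ suc v
      positive {k} {l} k<l with l ∸ k in eq
      ... | suc v = v , refl
      ... | zero  = contradiction (m∸n≡0⇒m≤n eq) (<⇒≱ k<l)

      R-complete : ∀ {xs y} → graph restricted xs y → ∃ λ t → ⟪ R ⟫ (t ∷ xs) ≡ suc y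
      R-complete {i ∷ x ∷ []} {y} (g , n , x<a , defined) =
        let t , p = uniformBound {Q = λ z s → ∃ λ v → ⟪ U ⟫ (s ∷ i ∷ z ∷ []) ≡ suc v} (α n)
                      (λ z z<a → let v , gz = defined z z<a
                                     t , p = eventually universalStages {i ∷ z ∷ []} gz
                                 in t , λ s t≤s → v , p s t≤s)
            u , q = eventually universalStages {i ∷ x ∷ []} g
            s     = t ⊔ u
        in ⟨ n , s ⟩ , subst₂
             (λ n s → guard (α n ∸ x) (guard (⟪ forAllBelow definedAt ⟫ (α n ∷ s ∷ i ∷ []))
                        (⟪ U ⟫ (s ∷ i ∷ x ∷ []))) ≡ suc y)
             (sym (left-⟨⟩ n s)) (sym (right-⟨⟩ n s))
             (guard-suc⁺ (proj₂ (positive x<a))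
               (guard-suc⁺ (proj₂ (forAllBelow-complete definedAt (α n) (p s (m≤m⊔n t u))))
                 (q s (m≤n⊔m t u))))

    restrictedIndex : ∃ λ s → total 1 s ∈ 𝓡 × (∀ i → φ at (s i) ≈ section restricted i)
    restrictedIndex = smn restricted restricted∈𝓟

  s : ℕ → ℕ
  s = proj₁ restrictedIndex

  φ∘s : ∀ i xs y → graph (φ at (s i)) xs y ⇔ graph restricted (i ∷ xs) y
  φ∘s = proj₂ (proj₂ restrictedIndex)

  h : ℕ → ℕ
  h = toθ ∘ s

  h∈𝓡 : total 1 h ∈ 𝓡
  h∈𝓡 = ∘∈𝓡 toθ∈𝓡 (proj₁ (proj₂ restrictedIndex))

  -- The `n` that admits `x` also admits every other point below `α n`, so the restriction retains
  -- that segment whole.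
  φ∘s-initial : ∀ i x → Dom (φ at (s i)) x →
    ∃ λ a → a ∈ A × x < a × (∀ z → z < a → Dom (φ at (s i)) z)
  φ∘s-initial i x (y , g) with _ , n , x<a , defined ← to (φ∘s i (x ∷ []) y) g =
    α n , proj₂ A≐α (n , refl) , x<a , λ z z<a →
      let v , gz = defined z z<a
      in v , from (φ∘s i (z ∷ []) v) (gz , n , z<a , defined)

  φ∘s-downward : ∀ i {x z} → z ≤ x → Dom (φ at (s i)) x → Dom (φ at (s i)) z
  φ∘s-downward i z≤x def with _ , _ , x<a , defined ← φ∘s-initial i _ def = defined _ (≤-<-trans z≤x x<a)

  -- Descend from an undefined point to the edge of the domain. If `x` is in the domain and `suc x`
  -- is not, a retained segment of length `a > x` must have `a = suc x` and be the whole domain.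
  bounded⇒¬¬Anf : ∀ i x → ¬ Dom (φ at (s i)) x → ¬ ¬ (φ at (s i) ∈ Anf A)
  bounded⇒¬¬Anf i zero ¬def ¬Anf =
    ¬Anf (inj₁ ((λ def → ¬def (φ∘s-downward i z≤n def)) , λ ()))
  bounded⇒¬¬Anf i (suc x) ¬def ¬Anf = ¬¬-excluded-middle λ
    { (no  ¬defₓ) → bounded⇒¬¬Anf i x ¬defₓ ¬Anf
    ; (yes defₓ)  →
        let a , a∈A , x<a , defined = φ∘s-initial i x defₓ
        in ¬Anf (inj₂ (a , a∈A
             , (λ def → ≰⇒> λ a≤z → ¬def (φ∘s-downward i (≤-trans x<a a≤z) def))
             , λ z<a → defined _ z<a))
    }

  -- If the restriction is not in `𝓢 A`, no point can be undefined, since that would give `Anf A` up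
  -- to double negation. By `φ-dom-stable` it is then total, hence in `𝓡` after all.
  ¬¬φ∘s∈𝓢 : ∀ i → ¬ ¬ (φ at (s i) ∈ 𝓢 A)
  ¬¬φ∘s∈𝓢 i ∉𝓢 = ∉𝓢 (inj₁ (φ∈𝓟 (s i) , λ { (x ∷ []) →
    φ-dom-stable (s i) x λ ¬def → bounded⇒¬¬Anf i x ¬def (∉𝓢 ∘ inj₂) }))

  ¬¬φ∘s≈θ∘h : ∀ i x y → ¬ ¬ (graph (φ at (s i)) (x ∷ []) y ⇔ graph (θ at (h i)) (x ∷ []) y)
  ¬¬φ∘s≈θ∘h i x y k = ¬¬φ∘s∈𝓢 i λ ∈𝓢 → k (φ≈θ∘toθ (s i) ∈𝓢 (x ∷ []) y)

  φ∘s-cong : ∀ i j → φ at i ≈ φ at j → ∀ x y → graph (φ at (s i)) (x ∷ []) y → graph (φ at (s j)) (x ∷ []) y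
  φ∘s-cong i j e x y g with gᵢ , n , x<a , defined ← to (φ∘s i (x ∷ []) y) g =
    from (φ∘s j (x ∷ []) y) (to (e (x ∷ []) y) gᵢ , n , x<a , λ z z<a →
      let v , gz = defined z z<a in v , to (e (z ∷ []) v) gz)

  -- `toθ` itself may send indices of one function to unrelated places. Here both sides are, up to
  -- double negation, restrictions of the same function, and stability on `𝓢 A` removes the
  -- negations.
  θ∘h-cong : ∀ i j → φ at i ≈ φ at j → θ at (h i) ≈ θ at (h j)
  θ∘h-cong i j e = 𝓢-≈-stable (θ at h i) (θ at h j) (θ∈𝓢 (h i)) (θ∈𝓢 (h j)) λ x y k →
    ¬¬φ∘s≈θ∘h i x y λ eᵢ → ¬¬φ∘s≈θ∘h j x y λ eⱼ → k (mk⇔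
      (to eⱼ ∘ φ∘s-cong i j e x y ∘ from eᵢ)
      (to eᵢ ∘ φ∘s-cong j i (≈-sym (φ at i) (φ at j) e) x y ∘ from eⱼ))

  -- Shows that restriction loses no point of `p`. A total `p` needs members of `A` beyond every
  -- `x`; otherwise the domain is itself the segment.
  segment : ∀ p → p ∈ 𝓢 A → ∀ x → Dom p x → ¬ ¬ ∃ λ a → a ∈ A × x < a × (∀ z → z < a → Dom p z)
  segment p (inj₁ (_ , p-total)) x _ k =
    infinite⇒¬¬unbounded A-infinite x λ (a , a∈A , x<a) → k (a , a∈A , x<a , λ z _ → p-total (z ∷ []))
  segment p (inj₂ (inj₁ (dom⊆∅ , _))) x def = ⊥-elim (dom⊆∅ def)
  segment p (inj₂ (inj₂ (a , a∈A , dom⊆ , ⊆dom))) x def k = k (a , a∈A , dom⊆ def , λ _ → ⊆dom)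

  θ∘h-fixes : ∀ i p → p ∈ 𝓢 A → φ at i ≈ p → θ at (h i) ≈ p
  θ∘h-fixes i p p∈𝓢 e = 𝓢-≈-stable (θ at h i) p (θ∈𝓢 (h i)) p∈𝓢 λ x y k →
    ¬¬φ∘s≈θ∘h i x y λ eᵢ → ¬¬-excluded-middle λ
      -- The restriction is contained in `p`, so a pair missing from `p` is missing from both
      -- graphs.
      { (no  ¬g) → k (mk⇔ (λ g → to (e (x ∷ []) y) (proj₁ (to (φ∘s i (x ∷ []) y) (from eᵢ g))))
                          (λ g → ⊥-elim (¬g g)))
      ; (yes g)  → segment p p∈𝓢 x (y , g) λ (a , a∈A , x<a , defined) →
          let n , αn≡a = proj₁ A≐α a∈A
              below z  = λ z<αn → let v , gz = defined z (subst (z <_) αn≡a z<αn)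
                                  in v , from (e (z ∷ []) v) gz
              gₛ = from (φ∘s i (x ∷ []) y)
                     (from (e (x ∷ []) y) g , n , subst (x <_) (sym αn≡a) x<a , below)
          in k (mk⇔ (λ _ → g) (λ _ → to eᵢ gₛ))
      }

  -- An arbitrary choice of index; it need not respect `≈`, and `θ∘h-cong` makes the resulting `H`
  -- independent of it.
  index : Σ (PFun 1) 𝓟 → ℕ
  index (p , p∈𝓟) = proj₁ (φ-index p p∈𝓟)

  φ∘index : (P : Σ (PFun 1) 𝓟) → φ at (index P) ≈ proj₁ P
  φ∘index (p , p∈𝓟) = proj₂ (φ-index p p∈𝓟)

  retract : IsRetract (𝓢 A) θ φ
  retract = record
    { Z⊆𝓟        = λ {p} → 𝓢⊆𝓟 {p}
    ; ζ≤ₘφ       = θ≤ₘφ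
    ; H          = record
      { to         = H
      ; cong       = λ {P} {Q} → H-cong P Q
      ; surjective = λ { (q , q∈𝓢) → (q , 𝓢⊆𝓟 {q} q∈𝓢) , λ {P} e →
          θ∘h-fixes (index P) q q∈𝓢 (≈-trans (φ at index P) (proj₁ P) q (φ∘index P) e) }
      }
    ; idempotent = λ P → let Q = proj₁ (H P) , 𝓢⊆𝓟 {proj₁ (H P)} (proj₂ (H P)) in
        θ∘h-fixes (index Q) (proj₁ (H P)) (proj₂ (H P)) (φ∘index Q)
    -- The index chosen for `φ at i` may differ from `i`, but both index the same function.
    ; tracked    = h , h∈𝓡 , λ i → θ∘h-cong (index (Surjection.to φ i)) i (φ∘index (Surjection.to φ i))
    }
    where
    H : Σ (PFun 1) 𝓟 → Σ (PFun 1) (𝓢 A)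
    H P = Surjection.to θ (h (index P))
    H-cong : ∀ P Q → proj₁ P ≈ proj₁ Q → proj₁ (H P) ≈ proj₁ (H Q)
    H-cong P Q e = θ∘h-cong (index P) (index Q)
      (≈-trans (φ at index P) (proj₁ P) (φ at index Q) (φ∘index P)
        (≈-trans (proj₁ P) (proj₁ Q) (φ at index Q) e (≈-sym (φ at index Q) (proj₁ Q) (φ∘index Q))))

theorem8p7 : (π : Pairing) (A : Pred ℕ 0ℓ) → Infinite A → CE A →
    (θ : Numbering (𝓢 A)) → IsQuasiGödel π A θ →
    (φ : Numbering 𝓟) → IsGödel φ →
    IsRetract (𝓢 A) θ φ
theorem8p7 π A A-infinite (inj₁ (A⊆∅ , _)) θ θ-qg φ φ-gödel =
  ⊥-elim (A-infinite ([] , λ a∈A → ⊥-elim (A⊆∅ a∈A)))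
theorem8p7 π A A-infinite (inj₂ (α , α∈𝓡 , A≐α)) θ θ-qg φ φ-gödel =
  Retraction.retract π A A-infinite α α∈𝓡 A≐α θ θ-qg φ φ-gödel
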